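{- Let $p$ be a prime and let $n$ be even. 1. Let $F\colon\mathbb{F}_{p^{n/2}}\times\mathbb{F}_{p^{n/2}}\to\mathbb{F}_p^m$ be a Maiorana–McFarland bent function defined by $F(x,y)=L(x\pi(y))+\rho(y)$, where $\pi\colon\mathbb{F}_{p^{n/2}}\to\mathbb{F}_{p^{n/2}}$ is a permutation, $\rho\colon\mathbb{F}_{p^{n/2}}\to\mathbb{F}_p^m$ is an arbitrary function, and $L\colon\mathbb{F}_{p^{n/2}}\to\mathbb{F}_p^m$ is a surjective linear mapping. Let $\pi(y^*)=0$ and $\alpha:=\rho(y^*)$ for $y^*\in\mathbb{F}_{p^{n/2}}$. Then $|F^{ -1}(\alpha)|=p^{n-m}+p^{n/2}-p^{n/2-m}$ and $|F^{ -1}(\beta)|=p^{n-m}-p^{n/2-m}$ for each $\beta\ne\alpha$, and hence $F$ is almost balanced of type $(+)$. 2. Let $F\colon\mathbb{F}_{p^{n/2}}\times\mathbb{F}_{p^{n/2}}\to\mathbb{F}_p^m$ be a Desarguesian partial spread bent function defined by $F(x,y)=\Psi(xy^{p^{n/2}-2})$, where $\Psi\colon\mathbb{F}_{p^{n/2}}\to\mathbb{F}_p^m$ is an arbitrary balanced function. Then $|F^{ -1}(0)|=p^{n-m}+p^{n/2}-p^{n/2-m}$ and $|F^{ -1}(\beta)|=p^{n-m}-p^{n/2-m}$ for each $\beta\neq 0$, and hence $F$ is almost balanced of type $(+)$.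
   Context: A function $F\colon\mathbb{F}_p^n\to\mathbb{F}_p^m$ is bent (perfect nonlinear) if $|\{x: F(x+a)-F(x)=b\}|=p^{n-m}$ for all nonzero $a\in\mathbb{F}_p^n$ and all $b\in\mathbb{F}_p^m$; here $\mathbb{F}_{p^{n/2}}\times\mathbb{F}_{p^{n/2}}$ is identified with $\mathbb{F}_p^n$ as an $\mathbb{F}_p$-vector space. A bent function $F\colon\mathbb{F}_p^n\to\mathbb{F}_p^m$ is almost balanced of type $(+)$ if there is $\alpha$ with $|F^{ -1}(\alpha)|=p^{n-m}+p^{n/2}-p^{n/2-m}$ and $|F^{ -1}(\beta)|=p^{n-m}-p^{n/2-m}$ for all $\beta\ne\alpha$. A function $\Psi\colon\mathbb{F}_{p^{n/2}}\to\mathbb{F}_p^m$ is balanced if all its preimage sets have size $p^{n/2-m}$. The expression $y^{p^{n/2}-2}$ stands for $y^{ -1}$ with the convention $0^{ -1}=0$.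
   Formalization: In part 2 the large preimage is that of Ψ(0) instead of 0, and β ranges over β ≠ Ψ(0); as printed the claim fails when Ψ(0) ≠ 0 (e.g. p=2, n=2, m=1, Ψ(x)=x+1, where |F^{ -1}(0)|=1, not 3). -}

module Defs where

open import Algebra.Bundles using (CommutativeRing)
open import Algebra.Bundles.Raw using (RawRing)
open import Algebra.Morphism.Structures using (IsRingHomomorphism)
open import Algebra.Structures using (IsCommutativeRing)
open import Data.Fin.Base using (Fin)
open import Data.Nat.Base as ℕ using (ℕ; _^_; _∸_)
open import Data.Nat.DivMod using (_/_)
open import Data.Product.Base using (_×_; _,_; ∃)
open import Data.Vec.Base using (Vec; map; zipWith)
open import Function.Bundles using (_↔_)
open import Level using (0ℓ)
open import Relation.Binary.PropositionalEquality.Core using (_≡_; _≢_)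

-- A field with exactly q elements.  The inverse is total, with 0⁻¹ = 0.
record FiniteField (q : ℕ) : Set₁ where
  infix  8 _⁻¹
  infix  8 -_
  infixl 7 _*_
  infixl 6 _+_
  field
    Carrier           : Set
    _+_ _*_           : Carrier → Carrier → Carrier
    -_ _⁻¹            : Carrier → Carrier
    0# 1#             : Carrier
    isCommutativeRing : IsCommutativeRing _≡_ _+_ _*_ -_ 0# 1#
    1#≢0#             : 1# ≢ 0#
    *-inverseʳ        : ∀ x → x ≢ 0# → x * x ⁻¹ ≡ 1#
    0#⁻¹≡0#           : 0# ⁻¹ ≡ 0#
    finite            : Carrier ↔ Fin q

  commutativeRing : CommutativeRing 0ℓ 0ℓ
  commutativeRing = record { isCommutativeRing = isCommutativeRing }

  open CommutativeRing commutativeRing public using (rawRing)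

open FiniteField using (Carrier)

-- K as an extension of 𝔽, via the structure map ι.
IsFieldEmbedding : ∀ {p q} (𝔽 : FiniteField p) (K : FiniteField q) → (Carrier 𝔽 → Carrier K) → Set
IsFieldEmbedding 𝔽 K = IsRingHomomorphism (FiniteField.rawRing 𝔽) (FiniteField.rawRing K)

-- Size statements are bijections:  Preimage F b ↔ Fin N  says |F⁻¹(b)| = N.
Preimage : {A B : Set} → (A → B) → B → Set
Preimage F b = ∃ λ x → F x ≡ b

module _ {p : ℕ} (𝔽 : FiniteField p) where

  private module 𝔽 = FiniteField 𝔽

  Space : ℕ → Set
  Space m = Vec 𝔽.Carrier m

  infixl 6 _⊕_ _⊖_
  infixl 7 _⊙_

  _⊕_ _⊖_ : ∀ {m} → Space m → Space m → Space m
  _⊕_ = zipWith 𝔽._+_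
  _⊖_ = zipWith (λ a b → a 𝔽.+ (𝔽.- b))

  _⊙_ : ∀ {m} → 𝔽.Carrier → Space m → Space m
  c ⊙ v = map (c 𝔽.*_) v

  -- 𝔽-linearity of L : K → 𝔽^m, where c in 𝔽 acts on K as multiplication by ι c.
  record IsLinear {q m : ℕ} (K : FiniteField q) (ι : 𝔽.Carrier → Carrier K)
                  (L : Carrier K → Space m) : Set where
    private module K = FiniteField K
    field
      +-homo : ∀ x y → L (x K.+ y) ≡ L x ⊕ L y
      ⊙-homo : ∀ c x → L (ι c K.* x) ≡ c ⊙ L x

  -- In IsBent, HasSizes⁺ and IsAlmostBalanced⁺, V plays the role of 𝔽^n; only its addition
  -- and zero matter.  Truncated subtraction in the exponents is harmless when |V| = pⁿ with n positive and even (the case of K × K below): the sizes of the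
  -- fibres have to add up to the size of the domain, which forces m ≤ n for bent
  -- functions and m ≤ n / 2 for the other notions.

  IsBent : {V : Set} (_+ᵥ_ : V → V → V) (0ᵥ : V) (n m : ℕ) → (V → Space m) → Set
  IsBent _+ᵥ_ 0ᵥ n m F =
    ∀ a → a ≢ 0ᵥ → ∀ b → Preimage (λ x → F (x +ᵥ a) ⊖ F x) b ↔ Fin (p ^ (n ∸ m))

  HasSizes⁺ : {V : Set} (n m : ℕ) → (V → Space m) → Space m → Set
  HasSizes⁺ n m F α =
    (Preimage F α ↔ Fin ((p ^ (n ∸ m) ℕ.+ p ^ (n / 2)) ∸ p ^ (n / 2 ∸ m)))
    × (∀ β → β ≢ α → Preimage F β ↔ Fin (p ^ (n ∸ m) ∸ p ^ (n / 2 ∸ m)))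

  -- Here n is the dimension of V × V, so V has dimension n / 2 and plays the
  -- role of the field of order p ^ (n / 2).
  IsBalanced : {V : Set} (n m : ℕ) → (V → Space m) → Set
  IsBalanced n m Ψ = ∀ b → Preimage Ψ b ↔ Fin (p ^ (n / 2 ∸ m))

  IsAlmostBalanced⁺ : {V : Set} (_+ᵥ_ : V → V → V) (0ᵥ : V) (n m : ℕ) → (V → Space m) → Set
  IsAlmostBalanced⁺ _+ᵥ_ 0ᵥ n m F =
    IsBent _+ᵥ_ 0ᵥ n m F × ∃ λ α → HasSizes⁺ n m F α

  module _ {q : ℕ} (K : FiniteField q) where

    private module K = FiniteField K

    Plane : Set
    Plane = K.Carrier × K.Carrier

    _+ₚ_ : Plane → Plane → Plane
    (x , y) +ₚ (x′ , y′) = x K.+ x′ , y K.+ y′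

    0ₚ : Plane
    0ₚ = K.0# , K.0#

    maioranaMcFarland : ∀ {m} → (K.Carrier → Space m) → (K.Carrier → K.Carrier) →
                        (K.Carrier → Space m) → Plane → Space m
    maioranaMcFarland L π ρ (x , y) = L (x K.* π y) ⊕ ρ y

    -- y ⁻¹ rather than y ^ (q ∸ 2): they differ at y = 0 when q = 2, where
    -- the convention 0⁻¹ = 0 is the intended one.
    partialSpread : ∀ {m} → (K.Carrier → Space m) → Plane → Space m
    partialSpread Ψ (x , y) = Ψ (x K.* (y K.⁻¹))

{-# OPTIONS --safe #-}

-- Every count is a bijection assembled slice by slice.  Write q = |K|, and call a function
-- on K balanced if its fibres all have the same size r = q / p^m; a surjective linear L
-- is balanced because its fibres are translates of the kernel.
--
-- Sizes: in both parts F(·, y) is balanced for every y but one, where it is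
-- constant.  This gives (q - 1) r, plus q at the constant value.
--
-- Bentness of L(x π(y)) + ρ(y): for a shift (a , b) with b ≠ 0 the derivative is balanced
-- in x for each y, and for b = 0 it is L(a π(y)), balanced in y for each x.
--
-- Bentness of Ψ(x y⁻¹): for b = 0 substitute t = x y⁻¹.  For b ≠ 0 let d = a / b and shear
-- x by d y; up to exchanging two slices by equally balanced ones, F becomes Φ(x y⁻¹) with
-- Φ(s) = Ψ(d + s) and the shift becomes (0 , b).  Substituting t = x y⁻¹ for fixed x, the
-- derivative is Φ((t⁻¹ + b x⁻¹)⁻¹) - Φ(t), which is balanced in x for each t.  The
-- convention 0⁻¹ = 0 makes inversion a bijection, so that x = 0 needs no correction.
module Submission where

open import Defs
open import Algebra.Bundles using (CommutativeRing)
import Algebra.Properties.AbelianGroup as AbelianGroupProperties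
import Algebra.Properties.Ring as RingProperties
open import Data.Empty using (⊥-elim)
open import Data.Fin.Base using (Fin; zero; suc)
open import Data.Fin.Permutation using (↔⇒≡; transpose)
import Data.Fin.Properties as Fin
open import Data.Nat.Base as ℕ using (ℕ; zero; suc; _∸_; _^_; _≤_)
open import Data.Nat.DivMod using (_/_; m/n*n≡m)
open import Data.Nat.Divisibility using (_∣_; divides; ∣⇒≤)
open import Data.Nat.Primality using (Prime; prime⇒nonTrivial)
import Data.Nat.Properties as ℕ
open import Data.Product.Base using (_×_; _,_; ∃; proj₁; proj₂)
open import Data.Product.Algebra using (Σ-assoc-alt)
open import Data.Product.Function.Dependent.Propositional using (Σ-↔)
open import Data.Product.Function.NonDependent.Propositional using (_×-↔_)
open import Data.Sum.Base using (_⊎_; inj₁; inj₂)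
open import Data.Sum.Function.Propositional using (_⊎-↔_)
open import Data.Vec.Base using ([]; _∷_; head; tail)
open import Data.Vec.Properties using (≡-dec; zipWith-comm)
open import Function.Base using (_∘_)
open import Function.Bundles using (_↔_; mk↔ₛ′; mk⤖; module Inverse)
open import Function.Definitions using (Bijective; Surjective)
open import Function.Properties.Bijection using (⤖⇒↔)
open import Function.Properties.Inverse using (↔-refl; ↔-sym; ↔-trans; Inverse⇒Injection)
open import Function.Related.TypeIsomorphisms using (∃∃↔∃∃)
open import Relation.Binary.Definitions using (DecidableEquality)
open import Relation.Binary.PropositionalEquality.Core using (_≡_; _≢_; refl; sym; trans; cong; cong₂; subst)
open import Relation.Binary.PropositionalEquality.Properties using (module ≡-Reasoning)
open import Relation.Binary.PropositionalEquality.WithK using (≡-irrelevant)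
open import Relation.Nullary.Decidable using (Dec; yes; no; via-injection)
open import Relation.Nullary.Negation using (contradiction)
open Inverse using (to; from; strictlyInverseˡ; strictlyInverseʳ)

private variable
  A B C X Y : Set
  r : ℕ

-- Equality proofs are unique, so a logical equivalence is already a bijection.
≡↔≡ : {a b : A} {c d : B} → (a ≡ b → c ≡ d) → (c ≡ d → a ≡ b) → a ≡ b ↔ c ≡ d
≡↔≡ f g = mk↔ₛ′ f g (λ _ → ≡-irrelevant _ _) (λ _ → ≡-irrelevant _ _)

fin-≡ : ∀ {k l} → k ≡ l → Fin k ↔ Fin l
fin-≡ refl = ↔-refl

-- Fibres of functions between finite sets

preimage-reindex : {f : A → C} {g : B → C} (e : A ↔ B) → (∀ x → f x ≡ g (to e x)) →
                   ∀ {c} → Preimage f c ↔ Preimage g c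
preimage-reindex e f≗g∘e = Σ-↔ e (λ {x} → ≡↔≡ (trans (sym (f≗g∘e x))) (trans (f≗g∘e x)))

preimage-slicesˡ : {f : A × B → C} {c : C} →
                   Preimage f c ↔ ∃ λ x → Preimage (λ y → f (x , y)) c
preimage-slicesˡ = Σ-assoc-alt

preimage-slicesʳ : {f : A × B → C} {c : C} →
                   Preimage f c ↔ ∃ λ y → Preimage (λ x → f (x , y)) c
preimage-slicesʳ = ↔-trans preimage-slicesˡ (∃∃↔∃∃ _)

-- The fibre size `r` is left free: for `L` it is the order of the kernel, identified as a power of
-- `p` only at the end, by counting.
Balanced : ℕ → (A → B) → Set
Balanced r f = ∀ b → Preimage f b ↔ Fin r

balanced-reindex : {f : A → C} {g : B → C} (e : A ↔ B) → (∀ x → f x ≡ g (to e x)) →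
                   Balanced r g → Balanced r f
balanced-reindex e f≗g∘e bal c = ↔-trans (preimage-reindex e f≗g∘e) (bal c)

balanced-post : {f : A → B} (g : B ↔ C) → Balanced r f → Balanced r (to g ∘ f)
balanced-post {f = f} g bal c = ↔-trans (Σ-↔ ↔-refl (≡↔≡ gf≡c⇒ ⇒gf≡c)) (bal (from g c))
  where
  gf≡c⇒ : ∀ {x} → to g (f x) ≡ c → f x ≡ from g c
  gf≡c⇒ eq = trans (sym (strictlyInverseʳ g _)) (cong (from g) eq)

  ⇒gf≡c : ∀ {x} → f x ≡ from g c → to g (f x) ≡ c
  ⇒gf≡c eq = trans (cong (to g) eq) (strictlyInverseˡ g c)

∃-const-size : ∀ {q} → A ↔ Fin q → {P : A → Set} → (∀ x → P x ↔ Fin r) → ∃ P ↔ Fin (q ℕ.* r)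
∃-const-size A↔ P↔ = ↔-trans (Σ-↔ A↔ (P↔ _)) (↔-sym Fin.*↔×)

∃-fin-suc : ∀ {n} {P : Fin (suc n) → Set} → ∃ P ↔ (P zero ⊎ ∃ (P ∘ suc))
∃-fin-suc = mk↔ₛ′
  (λ { (zero , x) → inj₁ x ; (suc i , x) → inj₂ (i , x) })
  (λ { (inj₁ x) → zero , x ; (inj₂ (i , x)) → suc i , x })
  (λ { (inj₁ _) → refl ; (inj₂ _) → refl })
  (λ { (zero , _) → refl ; (suc _ , _) → refl })

-- By induction, each index adds one element or none. This gives the kernel of `L` a size before its
-- order is known.
∃-decidable-size : ∀ {n} {P : Fin n → Set} → (∀ i → Dec (P i)) → (∀ {i} (x y : P i) → x ≡ y) →
                   ∃ λ s → ∃ P ↔ Fin s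
∃-decidable-size {zero}  P? irr = 0 , mk↔ₛ′ (λ ()) (λ ()) (λ ()) (λ ())
∃-decidable-size {suc n} {P} P? irr with ∃-decidable-size (P? ∘ suc) irr | P? zero
... | s , tail↔ | yes x = suc s ,
  ↔-trans ∃-fin-suc (↔-trans (mk↔ₛ′ (λ _ → zero) (λ _ → x) (λ { zero → refl }) (irr x) ⊎-↔ tail↔) (↔-sym (Fin.+↔⊎ {1})))
... | s , tail↔ | no ¬x = s ,
  ↔-trans ∃-fin-suc (↔-trans (mk↔ₛ′ (⊥-elim ∘ ¬x) (λ ()) (λ ()) (⊥-elim ∘ ¬x) ⊎-↔ tail↔) (↔-sym (Fin.+↔⊎ {0})))

transpose-self : ∀ {n} (i j : Fin n) → to (transpose i j) i ≡ j
transpose-self i j with i Fin.≟ i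
... | yes _  = refl
... | no i≢i = contradiction refl i≢i

-- A transposition moves `x*` to index zero, where its slice splits off. As `x*` exists, `q` is
-- positive, so the subtraction of one `r` is exact.
∃-size-except : ∀ {q u} → A ↔ Fin q → (x* : A) {P : A → Set} →
                P x* ↔ Fin u → (∀ x → x ≢ x* → P x ↔ Fin r) →
                ∃ P ↔ Fin ((q ℕ.* r ℕ.+ u) ∸ r)
∃-size-except {q = zero} A↔ x* = ⊥-elim (Fin.¬Fin0 (to A↔ x*))
∃-size-except {A = A} {r = r} {q = suc q} {u} A↔ x* {P} P*↔ P↔ =
  ↔-trans (↔-sym (Σ-↔ (↔-sym e) ↔-refl))
  (↔-trans ∃-fin-suc
  (↔-trans (head↔ ⊎-↔ tail↔)
  (↔-trans (↔-sym Fin.+↔⊎) (fin-≡ count))))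
  where
  e : A ↔ Fin (suc q)
  e = ↔-trans A↔ (transpose (to A↔ x*) zero)

  e* : to e x* ≡ zero
  e* = transpose-self (to A↔ x*) zero

  head↔ : P (from e zero) ↔ Fin u
  head↔ = subst (λ x → P x ↔ Fin u) (trans (sym (strictlyInverseʳ e x*)) (cong (from e) e*)) P*↔

  from≢ : ∀ i → from e (suc i) ≢ x*
  from≢ i eq with trans (sym (strictlyInverseˡ e (suc i))) (trans (cong (to e) eq) e*)
  ... | ()

  tail↔ : ∃ (P ∘ from e ∘ suc) ↔ Fin (q ℕ.* r)
  tail↔ = ∃-const-size ↔-refl (λ i → P↔ _ (from≢ i))

  count : u ℕ.+ q ℕ.* r ≡ (r ℕ.+ q ℕ.* r ℕ.+ u) ∸ r
  count = begin
    u ℕ.+ q ℕ.* r               ≡⟨ ℕ.+-comm u _ ⟩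
    q ℕ.* r ℕ.+ u               ≡⟨ ℕ.m+n∸m≡n r _ ⟨
    r ℕ.+ (q ℕ.* r ℕ.+ u) ∸ r   ≡⟨ cong (_∸ r) (ℕ.+-assoc r _ u) ⟨
    (r ℕ.+ q ℕ.* r ℕ.+ u) ∸ r   ∎
    where open ≡-Reasoning

constant-size-≡ : ∀ {q} {f : A → B} {c} → A ↔ Fin q → (∀ x → f x ≡ c) → Preimage f c ↔ Fin q
constant-size-≡ A↔ f≡c = ↔-trans
  (mk↔ₛ′ proj₁ (λ x → x , f≡c x) (λ _ → refl) (λ { (x , _) → cong (x ,_) (≡-irrelevant _ _) })) A↔

constant-size-≢ : {f : A → B} {b c : B} → (∀ x → f x ≡ c) → b ≢ c → Preimage f b ↔ Fin 0
constant-size-≢ {f = f} {b} f≡c b≢c = mk↔ₛ′ (⊥-elim ∘ absurd) (λ ()) (λ ()) (⊥-elim ∘ absurd)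
  where
  absurd : Preimage f b → _
  absurd (x , eq) = b≢c (trans (sym eq) (f≡c x))

-- The domain is the disjoint union of the fibres, one for each of the `N` values.
balanced-size : ∀ {q N} {f : A → B} → A ↔ Fin q → B ↔ Fin N → Balanced r f → N ℕ.* r ≡ q
balanced-size {f = f} A↔ B↔ bal = ↔⇒≡ (↔-trans (↔-sym (∃-const-size B↔ bal)) (↔-trans (↔-sym A↔∃) A↔))
  where
  A↔∃ : _ ↔ ∃ (Preimage f)
  A↔∃ = mk↔ₛ′ (λ x → f x , x , refl) (proj₁ ∘ proj₂) (λ { (_ , _ , refl) → refl }) (λ _ → refl)

module _ {q : ℕ} {f : X × Y → C} {y* : Y} {α : C} (X↔ : X ↔ Fin q) (Y↔ : Y ↔ Fin q)
         (constant : ∀ x → f (x , y*) ≡ α) (balanced : ∀ y → y ≢ y* → Balanced r (λ x → f (x , y)))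
         where

  size-at-constant : Preimage f α ↔ Fin ((q ℕ.* r ℕ.+ q) ∸ r)
  size-at-constant = ↔-trans preimage-slicesʳ
    (∃-size-except Y↔ y* (constant-size-≡ X↔ constant) (λ y y≢ → balanced y y≢ α))

  size-off-constant : ∀ β → β ≢ α → Preimage f β ↔ Fin (q ℕ.* r ∸ r)
  size-off-constant β β≢α = ↔-trans preimage-slicesʳ (↔-trans
    (∃-size-except Y↔ y* (constant-size-≢ constant β≢α) (λ y y≢ → balanced y y≢ β))
    (fin-≡ (cong (_∸ r) (ℕ.+-identityʳ _))))

-- If `m` exceeded `k`, then `p ^ m` would be a divisor of `p ^ k` larger than it. Once `m ≤ k`,
-- cancelling `p ^ m` determines `r`.
power-divisor : ∀ {p} → 1 ℕ.< p → ∀ {m k} → p ^ m ℕ.* r ≡ p ^ k → m ≤ k × r ≡ p ^ (k ∸ m)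
power-divisor {r} {p} 1<p {m} {k} eq = m≤k , r≡
  where
  instance
    _ = ℕ.>-nonZero (ℕ.<-trans ℕ.z<s 1<p)
    _ = ℕ.m^n≢0 p m
    _ = ℕ.m^n≢0 p k

  m≤k : m ≤ k
  m≤k with m ℕ.≤? k
  ... | yes m≤k = m≤k
  ... | no  m≰k = contradiction (∣⇒≤ (divides r (trans (sym eq) (ℕ.*-comm _ r))))
                                (ℕ.<⇒≱ (ℕ.^-monoʳ-< p 1<p (ℕ.≰⇒> m≰k)))

  r≡ : r ≡ p ^ (k ∸ m)
  r≡ = ℕ.*-cancelˡ-≡ r _ (p ^ m) (trans eq
    (trans (cong (p ^_) (sym (ℕ.m+[n∸m]≡n m≤k))) (ℕ.^-distribˡ-+-* p m (k ∸ m))))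

-- Arithmetic and the permutations of a finite field

module FieldProperties {q : ℕ} (K : FiniteField q) where

  open FiniteField K
  open CommutativeRing commutativeRing public
    using (+-assoc; +-comm; +-identityˡ; +-identityʳ; -‿inverseˡ; -‿inverseʳ;
           *-assoc; *-comm; *-identityˡ; zeroˡ; zeroʳ; distribˡ; distribʳ; +-abelianGroup; ring)
  open AbelianGroupProperties +-abelianGroup public
    using (//-rightDividesˡ; //-rightDividesʳ; \\-leftDividesˡ; \\-leftDividesʳ;
           x∙y⁻¹≈ε⇒x≈y; xyx⁻¹≈y; ⁻¹-anti-homo‿-; ⁻¹-∙-comm)
  open RingProperties ring using ([y-z]x≈yx-zx)
  open ≡-Reasoning

  _≟_ : DecidableEquality Carrier
  _≟_ = via-injection (Inverse⇒Injection finite) Fin._≟_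

  *-inverseˡ : ∀ x → x ≢ 0# → x ⁻¹ * x ≡ 1#
  *-inverseˡ x x≢0 = trans (*-comm _ x) (*-inverseʳ x x≢0)

  *-cancel-⁻¹ˡ : ∀ {x} → x ≢ 0# → ∀ y → x * (x ⁻¹ * y) ≡ y
  *-cancel-⁻¹ˡ {x} x≢0 y = begin
    x * (x ⁻¹ * y)  ≡⟨ *-assoc x _ y ⟨
    x * x ⁻¹ * y    ≡⟨ cong (_* y) (*-inverseʳ x x≢0) ⟩
    1# * y          ≡⟨ *-identityˡ y ⟩
    y               ∎

  ⁻¹-cancel-*ˡ : ∀ {x} → x ≢ 0# → ∀ y → x ⁻¹ * (x * y) ≡ y
  ⁻¹-cancel-*ˡ {x} x≢0 y = begin
    x ⁻¹ * (x * y)  ≡⟨ *-assoc _ x y ⟨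
    x ⁻¹ * x * y    ≡⟨ cong (_* y) (*-inverseˡ x x≢0) ⟩
    1# * y          ≡⟨ *-identityˡ y ⟩
    y               ∎

  ⁻¹-unique : ∀ {x y} → x * y ≡ 1# → y ≡ x ⁻¹
  ⁻¹-unique {x} {y} xy≡1 = begin
    y               ≡⟨ ⁻¹-cancel-*ˡ x≢0 y ⟨
    x ⁻¹ * (x * y)  ≡⟨ cong (x ⁻¹ *_) xy≡1 ⟩
    x ⁻¹ * 1#       ≡⟨ trans (*-comm _ 1#) (*-identityˡ _) ⟩
    x ⁻¹            ∎
    where
    x≢0 : x ≢ 0#
    x≢0 refl = 1#≢0# (trans (sym xy≡1) (zeroˡ y))

  ⁻¹-≢0 : ∀ {x} → x ≢ 0# → x ⁻¹ ≢ 0#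
  ⁻¹-≢0 {x} x≢0 eq = 1#≢0# (trans (sym (*-inverseʳ x x≢0)) (trans (cong (x *_) eq) (zeroʳ x)))

  ⁻¹-involutive : ∀ x → x ⁻¹ ⁻¹ ≡ x
  ⁻¹-involutive x with x ≟ 0#
  ... | yes refl = trans (cong _⁻¹ 0#⁻¹≡0#) 0#⁻¹≡0#
  ... | no  x≢0  = sym (⁻¹-unique (*-inverseˡ x x≢0))

  x*0⁻¹≡0 : ∀ x → x * 0# ⁻¹ ≡ 0#
  x*0⁻¹≡0 x = trans (cong (x *_) 0#⁻¹≡0#) (zeroʳ x)

  ⁻¹-distrib-* : ∀ x y → (x * y) ⁻¹ ≡ x ⁻¹ * y ⁻¹
  ⁻¹-distrib-* x y with x ≟ 0# | y ≟ 0#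
  ... | yes refl | _ = begin
    (0# * y) ⁻¹    ≡⟨ cong _⁻¹ (zeroˡ y) ⟩
    0# ⁻¹          ≡⟨ 0#⁻¹≡0# ⟩
    0#             ≡⟨ trans (*-comm _ _) (x*0⁻¹≡0 _) ⟨
    0# ⁻¹ * y ⁻¹   ∎
  ... | no _ | yes refl = begin
    (x * 0#) ⁻¹    ≡⟨ cong _⁻¹ (zeroʳ x) ⟩
    0# ⁻¹          ≡⟨ 0#⁻¹≡0# ⟩
    0#             ≡⟨ x*0⁻¹≡0 _ ⟨
    x ⁻¹ * 0# ⁻¹   ∎
  ... | no x≢0 | no y≢0 = sym (⁻¹-unique (begin
    x * y * (x ⁻¹ * y ⁻¹)     ≡⟨ *-assoc x y _ ⟩
    x * (y * (x ⁻¹ * y ⁻¹))   ≡⟨ cong (λ z → x * (y * z)) (*-comm _ _) ⟩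
    x * (y * (y ⁻¹ * x ⁻¹))   ≡⟨ cong (x *_) (*-cancel-⁻¹ˡ y≢0 _) ⟩
    x * x ⁻¹                  ≡⟨ *-inverseʳ x x≢0 ⟩
    1#                        ∎))

  +↔ : Carrier → Carrier ↔ Carrier
  +↔ a = mk↔ₛ′ (a +_) (- a +_) (\\-leftDividesˡ a) (\\-leftDividesʳ a)

  *↔ : ∀ {a} → a ≢ 0# → Carrier ↔ Carrier
  *↔ {a} a≢0 = mk↔ₛ′ (a *_) (a ⁻¹ *_) (*-cancel-⁻¹ˡ a≢0) (⁻¹-cancel-*ˡ a≢0)

  ⁻¹↔ : Carrier ↔ Carrier
  ⁻¹↔ = mk↔ₛ′ _⁻¹ _⁻¹ ⁻¹-involutive ⁻¹-involutive

  y+[x-y]≡x : ∀ x y → y + (x + - y) ≡ x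
  y+[x-y]≡x x y = trans (+-comm y _) (//-rightDividesˡ y x)

  -- Meant for `s = π y` and `t = π (y + b)`: the term `x * s` cancels in the derivative, and what
  -- remains is affine in `x` with slope `t - s`.
  affine-shift : ∀ a x s t → (x + a) * t ≡ x * s + (a * t + (t + - s) * x)
  affine-shift a x s t = begin
    (x + a) * t                          ≡⟨ distribʳ t x a ⟩
    x * t + a * t                        ≡⟨ cong (_+ a * t) (*-comm x t) ⟩
    t * x + a * t                        ≡⟨ cong (_+ a * t) (y+[x-y]≡x (t * x) (s * x)) ⟨
    s * x + (t * x + - (s * x)) + a * t  ≡⟨ cong (λ z → s * x + z + a * t) ([y-z]x≈yx-zx x t s) ⟨
    s * x + (t + - s) * x + a * t        ≡⟨ +-assoc (s * x) _ _ ⟩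
    s * x + ((t + - s) * x + a * t)      ≡⟨ cong₂ _+_ (*-comm s x) (+-comm _ _) ⟩
    x * s + (a * t + (t + - s) * x)      ∎

-- Coordinatewise arithmetic, translations and size of 𝔽^m

module SpaceProperties {p : ℕ} (𝔽 : FiniteField p) where

  private
    module 𝔽 = FiniteField 𝔽
    module P = FieldProperties 𝔽

    infixl 6 _⊞_ _⊟_

    _⊞_ _⊟_ : ∀ {m} → Space 𝔽 m → Space 𝔽 m → Space 𝔽 m
    _⊞_ = _⊕_ 𝔽
    _⊟_ = _⊖_ 𝔽

  open ≡-Reasoning

  ⊟-⊞-cancel : ∀ {m} (u v : Space 𝔽 m) → (u ⊟ v) ⊞ v ≡ u
  ⊟-⊞-cancel []      []      = refl
  ⊟-⊞-cancel (a ∷ u) (b ∷ v) = cong₂ _∷_ (P.//-rightDividesˡ b a) (⊟-⊞-cancel u v)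

  ⊞-⊟-cancel : ∀ {m} (u v : Space 𝔽 m) → (u ⊞ v) ⊟ v ≡ u
  ⊞-⊟-cancel []      []      = refl
  ⊞-⊟-cancel (a ∷ u) (b ∷ v) = cong₂ _∷_ (P.//-rightDividesʳ b a) (⊞-⊟-cancel u v)

  ⊟-⊟-cancel : ∀ {m} (u v : Space 𝔽 m) → u ⊟ (u ⊟ v) ≡ v
  ⊟-⊟-cancel []      []      = refl
  ⊟-⊟-cancel (a ∷ u) (b ∷ v) = cong₂ _∷_ (begin
    a 𝔽.+ 𝔽.- (a 𝔽.+ 𝔽.- b)  ≡⟨ cong (a 𝔽.+_) (P.⁻¹-anti-homo‿- a b) ⟩
    a 𝔽.+ (b 𝔽.+ 𝔽.- a)      ≡⟨ P.y+[x-y]≡x b a ⟩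
    b                        ∎) (⊟-⊟-cancel u v)

  -- The zero vector is never named; any `u ⊟ u` stands for it.
  ⊟-self : ∀ {m} (u v : Space 𝔽 m) → u ⊟ u ≡ v ⊟ v
  ⊟-self []      []      = refl
  ⊟-self (a ∷ u) (b ∷ v) = cong₂ _∷_ (trans (P.-‿inverseʳ a) (sym (P.-‿inverseʳ b))) (⊟-self u v)

  ⊞-identityʳ : ∀ {m} (u v : Space 𝔽 m) → u ⊞ (v ⊟ v) ≡ u
  ⊞-identityʳ []      []      = refl
  ⊞-identityʳ (a ∷ u) (b ∷ v) =
    cong₂ _∷_ (trans (cong (a 𝔽.+_) (P.-‿inverseʳ b)) (P.+-identityʳ a)) (⊞-identityʳ u v)

  ⊞-comm : ∀ {m} (u v : Space 𝔽 m) → u ⊞ v ≡ v ⊞ u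
  ⊞-comm = zipWith-comm P.+-comm

  ⊞-⊟-interchange : ∀ {m} (u v s t : Space 𝔽 m) → (u ⊞ v ⊞ s) ⊟ (u ⊞ t) ≡ v ⊞ (s ⊟ t)
  ⊞-⊟-interchange []      []      []      []      = refl
  ⊞-⊟-interchange (a ∷ u) (b ∷ v) (c ∷ s) (d ∷ t) = cong₂ _∷_ (begin
    a 𝔽.+ b 𝔽.+ c 𝔽.+ 𝔽.- (a 𝔽.+ d)            ≡⟨ cong₂ 𝔽._+_ (P.+-assoc a b c) (sym (P.⁻¹-∙-comm a d)) ⟩
    a 𝔽.+ (b 𝔽.+ c) 𝔽.+ (𝔽.- a 𝔽.+ 𝔽.- d)      ≡⟨ P.+-assoc _ _ _ ⟨
    a 𝔽.+ (b 𝔽.+ c) 𝔽.+ 𝔽.- a 𝔽.+ 𝔽.- d        ≡⟨ cong (𝔽._+ 𝔽.- d) (P.xyx⁻¹≈y a _) ⟩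
    b 𝔽.+ c 𝔽.+ 𝔽.- d                          ≡⟨ P.+-assoc b c _ ⟩
    b 𝔽.+ (c 𝔽.+ 𝔽.- d)                        ∎) (⊞-⊟-interchange u v s t)

  ⊞↔ : ∀ {m} → Space 𝔽 m → Space 𝔽 m ↔ Space 𝔽 m
  ⊞↔ v = mk↔ₛ′ (_⊞ v) (_⊟ v) (λ u → ⊟-⊞-cancel u v) (λ u → ⊞-⊟-cancel u v)

  ⊟↔ : ∀ {m} → Space 𝔽 m → Space 𝔽 m ↔ Space 𝔽 m
  ⊟↔ u = mk↔ₛ′ (u ⊟_) (u ⊟_) (⊟-⊟-cancel u) (⊟-⊟-cancel u)

  space-size : ∀ m → Space 𝔽 m ↔ Fin (p ^ m)
  space-size zero    = mk↔ₛ′ (λ _ → zero) (λ _ → []) (λ { zero → refl }) (λ { [] → refl })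
  space-size (suc m) = ↔-trans
    (mk↔ₛ′ (λ v → head v , tail v) (λ (a , v) → a ∷ v) (λ _ → refl) (λ { (_ ∷ _) → refl }))
    (↔-trans (𝔽.finite ×-↔ space-size m) (↔-sym Fin.*↔×))

  _≟ₛ_ : ∀ {m} → DecidableEquality (Space 𝔽 m)
  _≟ₛ_ = ≡-dec P._≟_

module _ {p q m : ℕ} (𝔽 : FiniteField p) (K : FiniteField q) where

  open FiniteField K
  open FieldProperties K
  open SpaceProperties 𝔽
  open ≡-Reasoning

  private
    infixl 6 _⊞_ _⊟_

    _⊞_ _⊟_ : Space 𝔽 m → Space 𝔽 m → Space 𝔽 m
    _⊞_ = _⊕_ 𝔽
    _⊟_ = _⊖_ 𝔽

    Δ : (Plane 𝔽 K → Space 𝔽 m) → Plane 𝔽 K → Plane 𝔽 K → Space 𝔽 m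
    Δ F a x = F (_+ₚ_ 𝔽 K x a) ⊟ F x

    plane≢0 : ∀ {a b} → (a , b) ≢ 0ₚ 𝔽 K → b ≡ 0# → a ≢ 0#
    plane≢0 v≢0 refl refl = v≢0 refl

  -- Maiorana–McFarland functions

  module _ {ι : FiniteField.Carrier 𝔽 → Carrier} {L : Carrier → Space 𝔽 m} (linear : IsLinear 𝔽 K ι L) where

    open IsLinear linear

    -- Translation by `x₀` carries the kernel, written as the fibre over `L 0#`, onto the fibre
    -- through `x₀`.
    linear-fibre↔kernel : ∀ x₀ → Preimage L (L x₀) ↔ Preimage L (L 0#)
    linear-fibre↔kernel x₀ = ↔-sym (Σ-↔ (+↔ x₀) (λ {x} → ≡↔≡ (shift x) (unshift x)))
      where
      shift : ∀ x → L x ≡ L 0# → L (x₀ + x) ≡ L x₀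
      shift x eq = begin
        L (x₀ + x)     ≡⟨ +-homo x₀ x ⟩
        L x₀ ⊞ L x     ≡⟨ cong (L x₀ ⊞_) eq ⟩
        L x₀ ⊞ L 0#    ≡⟨ +-homo x₀ 0# ⟨
        L (x₀ + 0#)    ≡⟨ cong L (+-identityʳ x₀) ⟩
        L x₀           ∎

      unshift : ∀ x → L (x₀ + x) ≡ L x₀ → L x ≡ L 0#
      unshift x eq = begin
        L x                        ≡⟨ ⊞-⊟-cancel (L x) (L x₀) ⟨
        (L x ⊞ L x₀) ⊟ L x₀        ≡⟨ cong (_⊟ L x₀) (trans (⊞-comm _ _) (sym (+-homo x₀ x))) ⟩
        L (x₀ + x) ⊟ L x₀          ≡⟨ cong (λ v → v ⊟ L x₀) eq ⟩
        -- The first `L x₀` is expanded as `L (0# + x₀)`, so that additivity brings out `L 0#`.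
        L x₀ ⊟ L x₀                ≡⟨ cong (λ x → L x ⊟ L x₀) (+-identityˡ x₀) ⟨
        L (0# + x₀) ⊟ L x₀         ≡⟨ cong (_⊟ L x₀) (+-homo 0# x₀) ⟩
        (L 0# ⊞ L x₀) ⊟ L x₀       ≡⟨ ⊞-⊟-cancel (L 0#) (L x₀) ⟩
        L 0#                       ∎

    -- Equality in 𝔽^m is decidable, so the kernel has some size `s`. Surjectivity puts a point `x₀`
    -- in every fibre, which is then a translate of the kernel.
    linear-surjective⇒balanced : Surjective _≡_ _≡_ L → ∃ λ s → Balanced s L
    linear-surjective⇒balanced surj = proj₁ kernel , fibre
      where
      kernel : ∃ λ s → Preimage L (L 0#) ↔ Fin s
      kernel = let s , ker↔ = ∃-decidable-size (λ i → L (from finite i) ≟ₛ L 0#) ≡-irrelevant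
               in s , ↔-trans (↔-sym (Σ-↔ (↔-sym finite) ↔-refl)) ker↔

      fibre : Balanced (proj₁ kernel) L
      fibre b with surj b
      ... | x₀ , Lx₀≡ with Lx₀≡ refl
      ... | refl = ↔-trans (linear-fibre↔kernel x₀) (proj₂ kernel)

    -- Additivity gives `L 0# ⊞ L 0# ≡ L 0#`, so `L 0#` equals `L 0# ⊟ L 0#`, which is neutral.
    linear-0#-identityˡ : ∀ v → L 0# ⊞ v ≡ v
    linear-0#-identityˡ v = begin
      L 0# ⊞ v                             ≡⟨ cong (_⊞ v) (⊞-⊟-cancel (L 0#) (L 0#)) ⟨
      ((L 0# ⊞ L 0#) ⊟ L 0#) ⊞ v           ≡⟨ cong (λ w → (w ⊟ L 0#) ⊞ v) (+-homo 0# 0#) ⟨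
      (L (0# + 0#) ⊟ L 0#) ⊞ v             ≡⟨ cong (λ z → (L z ⊟ L 0#) ⊞ v) (+-identityˡ 0#) ⟩
      (L 0# ⊟ L 0#) ⊞ v                    ≡⟨ ⊞-comm _ v ⟩
      v ⊞ (L 0# ⊟ L 0#)                    ≡⟨ ⊞-identityʳ v (L 0#) ⟩
      v                                    ∎

    module _ (bal : Balanced r L) {π : Carrier → Carrier} (π-bij : Bijective _≡_ _≡_ π)
             (ρ : Carrier → Space 𝔽 m) where

      private
        F : Plane 𝔽 K → Space 𝔽 m
        F = maioranaMcFarland 𝔽 K L π ρ

        π↔ : Carrier ↔ Carrier
        π↔ = ⤖⇒↔ (mk⤖ π-bij)

      maioranaMcFarland-constant : ∀ {y*} → π y* ≡ 0# → ∀ x → F (x , y*) ≡ ρ y*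
      maioranaMcFarland-constant {y*} πy*≡0 x = begin
        L (x * π y*) ⊞ ρ y*  ≡⟨ cong (λ z → L z ⊞ ρ y*) (trans (cong (x *_) πy*≡0) (zeroʳ x)) ⟩
        L 0# ⊞ ρ y*          ≡⟨ linear-0#-identityˡ (ρ y*) ⟩
        ρ y*                 ∎

      maioranaMcFarland-balanced : ∀ {y*} → π y* ≡ 0# → ∀ y → y ≢ y* → Balanced r (λ x → F (x , y))
      maioranaMcFarland-balanced {y*} πy*≡0 y y≢y* = balanced-post (⊞↔ (ρ y))
        (balanced-reindex (*↔ πy≢0) (λ x → cong L (*-comm x (π y))) bal)
        where
        πy≢0 : π y ≢ 0#
        πy≢0 πy≡0 = y≢y* (proj₁ π-bij (trans πy≡0 (sym πy*≡0)))

      private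
        Δ-formula : ∀ a b x y → Δ F (a , b) (x , y) ≡
          L (a * π (y + b) + (π (y + b) + - π y) * x) ⊞ (ρ (y + b) ⊟ ρ y)
        Δ-formula a b x y = begin
          (L ((x + a) * π (y + b)) ⊞ ρ (y + b)) ⊟ (L (x * π y) ⊞ ρ y)
            ≡⟨ cong (λ v → (v ⊞ ρ (y + b)) ⊟ (L (x * π y) ⊞ ρ y))
                 (trans (cong L (affine-shift a x (π y) (π (y + b)))) (+-homo _ _)) ⟩
          (L (x * π y) ⊞ L (a * π (y + b) + (π (y + b) + - π y) * x) ⊞ ρ (y + b)) ⊟ (L (x * π y) ⊞ ρ y)
            ≡⟨ ⊞-⊟-interchange _ _ _ _ ⟩
          L (a * π (y + b) + (π (y + b) + - π y) * x) ⊞ (ρ (y + b) ⊟ ρ y)  ∎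

        Δ-formula₀ : ∀ a x y → Δ F (a , 0#) (x , y) ≡ L (a * π y)
        Δ-formula₀ a x y = begin
          Δ F (a , 0#) (x , y)                                             ≡⟨ Δ-formula a 0# x y ⟩
          L (a * π (y + 0#) + (π (y + 0#) + - π y) * x) ⊞ (ρ (y + 0#) ⊟ ρ y)
            ≡⟨ cong (λ z → L (a * π z + (π z + - π y) * x) ⊞ (ρ z ⊟ ρ y)) (+-identityʳ y) ⟩
          L (a * π y + (π y + - π y) * x) ⊞ (ρ y ⊟ ρ y)                    ≡⟨ ⊞-identityʳ _ (ρ y) ⟩
          L (a * π y + (π y + - π y) * x)
            ≡⟨ cong (λ z → L (a * π y + z)) (trans (cong (_* x) (-‿inverseʳ (π y))) (zeroˡ x)) ⟩
          L (a * π y + 0#)                                                 ≡⟨ cong L (+-identityʳ _) ⟩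
          L (a * π y)                                                      ∎

      maioranaMcFarland-derivative-balanced : ∀ {v} → v ≢ 0ₚ 𝔽 K → Balanced (q ℕ.* r) (Δ F v)
      maioranaMcFarland-derivative-balanced {a , b} v≢0 c with b ≟ 0#
      -- For `b = 0` the derivative does not depend on `x`, so the slices are taken at fixed `x`;
      -- here `a` is nonzero because the shift is.
      ... | yes refl = ↔-trans preimage-slicesˡ (∃-const-size finite (λ x → slice x c))
        where
        slice : ∀ x → Balanced r (λ y → Δ F (a , 0#) (x , y))
        slice x = balanced-reindex (↔-trans π↔ (*↔ (plane≢0 v≢0 refl))) (Δ-formula₀ a x) bal
      ... | no b≢0 = ↔-trans preimage-slicesʳ (∃-const-size finite (λ y → slice y c))
        where
        -- The slope of the affine function of `x` is nonzero: `π` is injective and `y + b` differs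
        -- from `y`.
        δ≢0 : ∀ y → π (y + b) + - π y ≢ 0#
        δ≢0 y eq = b≢0 (begin
          b                 ≡⟨ \\-leftDividesʳ y b ⟨
          - y + (y + b)     ≡⟨ cong (- y +_) (proj₁ π-bij (x∙y⁻¹≈ε⇒x≈y _ _ eq)) ⟩
          - y + y           ≡⟨ -‿inverseˡ y ⟩
          0#                ∎)

        slice : ∀ y → Balanced r (λ x → Δ F (a , b) (x , y))
        slice y = balanced-reindex ↔-refl (λ x → Δ-formula a b x y)
          (balanced-post (⊞↔ (ρ (y + b) ⊟ ρ y))
            (balanced-reindex (↔-trans (*↔ (δ≢0 y)) (+↔ (a * π (y + b)))) (λ _ → refl) bal))

  -- Desarguesian partial spread functions

  module _ {Ψ : Carrier → Space 𝔽 m} (bal : Balanced r Ψ) where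

    spread-slice-balanced : ∀ {u} → u ≢ 0# → Balanced r (λ x → Ψ (x * u))
    spread-slice-balanced {u} u≢0 = balanced-reindex (*↔ u≢0) (λ x → cong Ψ (*-comm x u)) bal

    -- Exchange the order of counting: for fixed `t`, the argument `from j (to j t + e * w ⁻¹)` is a
    -- permutation of `w`, so the difference is balanced in `w`. Horizontal shifts use the identity
    -- for `j`, vertical ones use inversion.
    twisted-difference-size : (j : Carrier ↔ Carrier) → ∀ {e} → e ≢ 0# → ∀ c →
      (∃ λ w → Preimage (λ t → Ψ (from j (to j t + e * w ⁻¹)) ⊟ Ψ t) c) ↔ Fin (q ℕ.* r)
    twisted-difference-size j {e} e≢0 c = ↔-trans (∃∃↔∃∃ _) (∃-const-size finite λ t →
      balanced-post (↔-sym (⊞↔ (Ψ t))) (balanced-reindex (w↔ t) (λ _ → refl) bal) c)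
      where
      w↔ : Carrier → Carrier ↔ Carrier
      w↔ t = ↔-trans ⁻¹↔ (↔-trans (*↔ e≢0) (↔-trans (+↔ (to j t)) (↔-sym j)))

    -- The derivative in direction (a , 0): put t = x y⁻¹ on the slice of each y.
    horizontal-derivative-size : ∀ {a} → a ≢ 0# → ∀ c →
      Preimage (λ (x , y) → Ψ ((x + a) * y ⁻¹) ⊟ Ψ (x * y ⁻¹)) c ↔ Fin (q ℕ.* r)
    horizontal-derivative-size {a} a≢0 c = ↔-trans preimage-slicesʳ
      (↔-trans (Σ-↔ ↔-refl (λ {y} → slice y)) (twisted-difference-size ↔-refl a≢0 c))
      where
      slice : ∀ y → Preimage (λ x → Ψ ((x + a) * y ⁻¹) ⊟ Ψ (x * y ⁻¹)) c ↔
                    Preimage (λ t → Ψ (t + a * y ⁻¹) ⊟ Ψ t) c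
      slice y with y ≟ 0#
      -- At `y = 0` the substitution degenerates, but both functions are identically the zero
      -- vector, so the identity reindexing suffices.
      ... | yes refl = preimage-reindex ↔-refl (λ x → begin
        Ψ ((x + a) * 0# ⁻¹) ⊟ Ψ (x * 0# ⁻¹)  ≡⟨ cong₂ (λ s t → Ψ s ⊟ Ψ t) (x*0⁻¹≡0 _) (x*0⁻¹≡0 x) ⟩
        Ψ 0# ⊟ Ψ 0#                          ≡⟨ ⊟-self _ _ ⟩
        Ψ x ⊟ Ψ x                            ≡⟨ cong (λ s → Ψ s ⊟ Ψ x) (+-identityʳ x) ⟨
        Ψ (x + 0#) ⊟ Ψ x                     ≡⟨ cong (λ s → Ψ (x + s) ⊟ Ψ x) (x*0⁻¹≡0 a) ⟨
        Ψ (x + a * 0# ⁻¹) ⊟ Ψ x              ∎)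
      ... | no y≢0 = preimage-reindex (*↔ (⁻¹-≢0 y≢0)) (λ x →
        cong₂ (λ s t → Ψ s ⊟ Ψ t)
          (trans (distribʳ (y ⁻¹) x a) (cong (_+ a * y ⁻¹) (*-comm x (y ⁻¹))))
          (*-comm x (y ⁻¹)))

    -- The derivative in direction (0 , b): put t = x y⁻¹ on the slice of each x,
    -- so that x (y + b)⁻¹ = (t⁻¹ + b x⁻¹)⁻¹.
    vertical-derivative-size : ∀ {b} → b ≢ 0# → ∀ c →
      Preimage (λ (x , y) → Ψ (x * (y + b) ⁻¹) ⊟ Ψ (x * y ⁻¹)) c ↔ Fin (q ℕ.* r)
    vertical-derivative-size {b} b≢0 c = ↔-trans preimage-slicesˡ
      (↔-trans (Σ-↔ ↔-refl (λ {x} → slice x)) (twisted-difference-size ⁻¹↔ b≢0 c))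
      where
      slice : ∀ x → Preimage (λ y → Ψ (x * (y + b) ⁻¹) ⊟ Ψ (x * y ⁻¹)) c ↔
                    Preimage (λ t → Ψ ((t ⁻¹ + b * x ⁻¹) ⁻¹) ⊟ Ψ t) c
      slice x with x ≟ 0#
      -- At `x = 0` both differences vanish identically; on the right this is because inverting
      -- twice returns `y`.
      ... | yes refl = preimage-reindex ↔-refl (λ y → begin
        Ψ (0# * (y + b) ⁻¹) ⊟ Ψ (0# * y ⁻¹)   ≡⟨ cong₂ (λ s t → Ψ s ⊟ Ψ t) (zeroˡ _) (zeroˡ _) ⟩
        Ψ 0# ⊟ Ψ 0#                           ≡⟨ ⊟-self _ _ ⟩
        Ψ y ⊟ Ψ y                             ≡⟨ cong (λ s → Ψ s ⊟ Ψ y) (⁻¹-involutive y) ⟨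
        Ψ (y ⁻¹ ⁻¹) ⊟ Ψ y                     ≡⟨ cong (λ s → Ψ (s ⁻¹) ⊟ Ψ y) (+-identityʳ _) ⟨
        Ψ ((y ⁻¹ + 0#) ⁻¹) ⊟ Ψ y              ≡⟨ cong (λ s → Ψ ((y ⁻¹ + s) ⁻¹) ⊟ Ψ y) (x*0⁻¹≡0 b) ⟨
        Ψ ((y ⁻¹ + b * 0# ⁻¹) ⁻¹) ⊟ Ψ y       ∎)
      ... | no x≢0 = preimage-reindex (↔-trans ⁻¹↔ (*↔ x≢0)) (λ y →
        cong (λ s → Ψ s ⊟ Ψ (x * y ⁻¹)) (sym (begin
          ((x * y ⁻¹) ⁻¹ + b * x ⁻¹) ⁻¹      ≡⟨ cong (λ s → (s + b * x ⁻¹) ⁻¹) (⁻¹-distrib-* x (y ⁻¹)) ⟩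
          (x ⁻¹ * y ⁻¹ ⁻¹ + b * x ⁻¹) ⁻¹     ≡⟨ cong (λ s → (x ⁻¹ * s + b * x ⁻¹) ⁻¹) (⁻¹-involutive y) ⟩
          (x ⁻¹ * y + b * x ⁻¹) ⁻¹           ≡⟨ cong (λ s → (x ⁻¹ * y + s) ⁻¹) (*-comm b _) ⟩
          (x ⁻¹ * y + x ⁻¹ * b) ⁻¹           ≡⟨ cong _⁻¹ (distribˡ (x ⁻¹) y b) ⟨
          (x ⁻¹ * (y + b)) ⁻¹                ≡⟨ ⁻¹-distrib-* (x ⁻¹) (y + b) ⟩
          x ⁻¹ ⁻¹ * (y + b) ⁻¹               ≡⟨ cong (_* (y + b) ⁻¹) (⁻¹-involutive x) ⟩
          x * (y + b) ⁻¹                     ∎)))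

  -- Slices and derivatives of partial spread functions

  module _ {Ψ : Carrier → Space 𝔽 m} (bal : Balanced r Ψ) where

    private
      F : Plane 𝔽 K → Space 𝔽 m
      F = partialSpread 𝔽 K Ψ

    -- The exceptional line is `y = 0`: the convention for the inverse of zero makes the quotient
    -- vanish there, so the distinguished value is `Ψ 0#`.
    partialSpread-constant : ∀ x → F (x , 0#) ≡ Ψ 0#
    partialSpread-constant x = cong Ψ (x*0⁻¹≡0 x)

    partialSpread-balanced : ∀ y → y ≢ 0# → Balanced r (λ x → F (x , y))
    partialSpread-balanced y y≢0 = spread-slice-balanced bal (⁻¹-≢0 y≢0)

    module _ (a : Carrier) {b : Carrier} (b≢0 : b ≢ 0#) where

      private
        d : Carrier
        d = b ⁻¹ * a

        Φ : Carrier → Space 𝔽 m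
        Φ s = Ψ (d + s)

        Φ-bal : Balanced r Φ
        Φ-bal = balanced-reindex (+↔ d) (λ _ → refl) bal

        ΔΦ : Plane 𝔽 K → Space 𝔽 m
        ΔΦ (x , y) = Φ (x * (y + b) ⁻¹) ⊟ Φ (x * y ⁻¹)

        -- Off the line `y = 0`, shearing by `d` translates the quotient of `x` by `y` by `d`, and
        -- `Φ` absorbs this translation.
        slope-shift : ∀ x {y} → y ≢ 0# → (y * d + x) * y ⁻¹ ≡ d + x * y ⁻¹
        slope-shift x {y} y≢0 = begin
          (y * d + x) * y ⁻¹           ≡⟨ distribʳ _ _ x ⟩
          y * d * y ⁻¹ + x * y ⁻¹      ≡⟨ cong (_+ x * y ⁻¹) (*-comm (y * d) _) ⟩
          y ⁻¹ * (y * d) + x * y ⁻¹    ≡⟨ cong (_+ x * y ⁻¹) (⁻¹-cancel-*ˡ y≢0 d) ⟩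
          d + x * y ⁻¹                 ∎

        -- Since `b * d ≡ a`, shearing and then shifting by `(a , b)` agrees with shifting by
        -- `(0# , b)` and then shearing.
        shear : ∀ x y → y * d + x + a ≡ (y + b) * d + x
        shear x y = begin
          y * d + x + a          ≡⟨ +-assoc _ x a ⟩
          y * d + (x + a)        ≡⟨ cong (y * d +_) (+-comm x a) ⟩
          y * d + (a + x)        ≡⟨ +-assoc _ a x ⟨
          y * d + a + x          ≡⟨ cong (λ s → y * d + s + x) (*-cancel-⁻¹ˡ b≢0 a) ⟨
          y * d + b * d + x      ≡⟨ cong (_+ x) (distribʳ d y b) ⟨
          (y + b) * d + x        ∎

        Φ-slice-balanced : ∀ {y} → y ≢ 0# → Balanced r (λ x → Φ (x * y ⁻¹))
        Φ-slice-balanced y≢0 = spread-slice-balanced Φ-bal (⁻¹-≢0 y≢0)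

        -- Shearing by d turns F into Φ (x y⁻¹) except where y = 0.  The two slices that
        -- meet y = 0 are balanced before and after, so they may be exchanged.
        slice : ∀ y c → Preimage (λ x → Δ F (a , b) (x , y)) c ↔ Preimage (λ x → ΔΦ (x , y)) c
        slice y c with y ≟ 0# | (y + b) ≟ 0#
        -- At `y = 0` the subtracted term is constant in `x`, and the other is balanced because
        -- `0# + b` is nonzero.
        ... | yes refl | _ = ↔-trans (F-balanced c) (↔-sym (Φ-balanced c))
          where
          0+b≢0 : 0# + b ≢ 0#
          0+b≢0 eq = b≢0 (trans (sym (+-identityˡ b)) eq)

          F-balanced : Balanced r (λ x → Δ F (a , b) (x , 0#))
          F-balanced = balanced-reindex (+↔ a)
            (λ x → cong₂ (λ s v → Ψ (s * (0# + b) ⁻¹) ⊟ v) (+-comm x a) (partialSpread-constant x))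
            (balanced-post (↔-sym (⊞↔ (Ψ 0#))) (partialSpread-balanced (0# + b) 0+b≢0))

          Φ-balanced : Balanced r (λ x → ΔΦ (x , 0#))
          Φ-balanced = balanced-reindex ↔-refl
            (λ x → cong (λ s → Φ (x * (0# + b) ⁻¹) ⊟ Φ s) (x*0⁻¹≡0 x))
            (balanced-post (↔-sym (⊞↔ (Φ 0#))) (Φ-slice-balanced 0+b≢0))
        -- At `y = - b` the shifted term is the constant one, so balance comes from the reflection
        -- `⊟↔` of the subtracted term.
        ... | no y≢0 | yes y+b≡0 = ↔-trans (F-balanced c) (↔-sym (Φ-balanced c))
          where
          [y+b]⁻¹-vanishes : ∀ x → x * (y + b) ⁻¹ ≡ 0#
          [y+b]⁻¹-vanishes x = trans (cong (λ s → x * s ⁻¹) y+b≡0) (x*0⁻¹≡0 x)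

          F-balanced : Balanced r (λ x → Δ F (a , b) (x , y))
          F-balanced = balanced-reindex ↔-refl
            (λ x → cong (λ s → Ψ s ⊟ F (x , y)) ([y+b]⁻¹-vanishes (x + a)))
            (balanced-post (⊟↔ (Ψ 0#)) (partialSpread-balanced y y≢0))

          Φ-balanced : Balanced r (λ x → ΔΦ (x , y))
          Φ-balanced = balanced-reindex ↔-refl
            (λ x → cong (λ s → Φ s ⊟ Φ (x * y ⁻¹)) ([y+b]⁻¹-vanishes x))
            (balanced-post (⊟↔ (Φ 0#)) (Φ-slice-balanced y≢0))
        -- Away from both exceptional slices, translation of `x` by `y * d` matches the two
        -- derivatives exactly.
        ... | no y≢0 | no y+b≢0 = ↔-sym (preimage-reindex (+↔ (y * d)) (λ x → sym (cong₂ (λ s t → Ψ s ⊟ Ψ t)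
          (trans (cong (_* (y + b) ⁻¹) (shear x y)) (slope-shift x y+b≢0))
          (slope-shift x y≢0))))

      -- The comparison is made at fixed `y`; the slices are then reassembled, since the count for
      -- the vertical shift of `Φ` slices by `x` instead.
      oblique-derivative-balanced : Balanced (q ℕ.* r) (Δ F (a , b))
      oblique-derivative-balanced c = ↔-trans preimage-slicesʳ
        (↔-trans (Σ-↔ ↔-refl (λ {y} → slice y c))
        (↔-trans (↔-sym preimage-slicesʳ) (vertical-derivative-size Φ-bal b≢0 c)))

    partialSpread-derivative-balanced : ∀ {v} → v ≢ 0ₚ 𝔽 K → Balanced (q ℕ.* r) (Δ F v)
    partialSpread-derivative-balanced {a , b} v≢0 c with b ≟ 0#
    ... | yes refl = ↔-trans
      (preimage-reindex ↔-refl (λ (x , y) → cong (λ s → Ψ ((x + a) * s ⁻¹) ⊟ Ψ (x * y ⁻¹)) (+-identityʳ y)))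
      (horizontal-derivative-size bal (plane≢0 v≢0 refl) c)
    ... | no b≢0 = oblique-derivative-balanced a b≢0 c

-- Exponent arithmetic and assembly of the two parts

-- Evenness gives `n / 2` twice as `n`, and `m ≤ n / 2` makes the truncated subtraction associate
-- with the sum.
q*r≡p^[n∸m] : ∀ p {n m} → 2 ∣ n → m ≤ n / 2 → p ^ (n / 2) ℕ.* p ^ (n / 2 ∸ m) ≡ p ^ (n ∸ m)
q*r≡p^[n∸m] p {n} {m} 2∣n m≤k = begin
  p ^ k ℕ.* p ^ (k ∸ m)   ≡⟨ ℕ.^-distribˡ-+-* p k (k ∸ m) ⟨
  p ^ (k ℕ.+ (k ∸ m))     ≡⟨ cong (p ^_) (ℕ.+-∸-assoc k m≤k) ⟨
  p ^ (k ℕ.+ k ∸ m)       ≡⟨ cong (λ l → p ^ (l ∸ m)) k+k≡n ⟩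
  p ^ (n ∸ m)             ∎
  where
  open ≡-Reasoning
  k = n / 2

  k+k≡n : k ℕ.+ k ≡ n
  k+k≡n = begin
    k ℕ.+ k            ≡⟨ cong (k ℕ.+_) (ℕ.+-identityʳ k) ⟨
    2 ℕ.* k            ≡⟨ ℕ.*-comm 2 k ⟩
    k ℕ.* 2            ≡⟨ m/n*n≡m 2∣n ⟩
    n                  ∎

-- Slicing yields counts in terms of `q * r`; the equation turns them into powers of `p`, and `α` is
-- the witness for type (+).
almostBalanced⁺ : ∀ {p n m} (𝔽 : FiniteField p) (K : FiniteField (p ^ (n / 2))) →
  let q = p ^ (n / 2); r = p ^ (n / 2 ∸ m) in
  q ℕ.* r ≡ p ^ (n ∸ m) → (F : Plane 𝔽 K → Space 𝔽 m) (α : Space 𝔽 m) →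
  (∀ {v} → v ≢ 0ₚ 𝔽 K → Balanced (q ℕ.* r) (λ x → _⊖_ 𝔽 (F (_+ₚ_ 𝔽 K x v)) (F x))) →
  Preimage F α ↔ Fin ((q ℕ.* r ℕ.+ q) ∸ r) →
  (∀ β → β ≢ α → Preimage F β ↔ Fin (q ℕ.* r ∸ r)) →
  (Preimage F α ↔ Fin ((p ^ (n ∸ m) ℕ.+ q) ∸ r))
  × (∀ β → β ≢ α → Preimage F β ↔ Fin (p ^ (n ∸ m) ∸ r))
  × IsAlmostBalanced⁺ 𝔽 (_+ₚ_ 𝔽 K) (0ₚ 𝔽 K) n m F
almostBalanced⁺ {p} {n} {m} 𝔽 K eq F α bent at off = at′ , off′ , bent′ , α , at′ , off′
  where
  at′ = ↔-trans at (fin-≡ (cong (λ s → (s ℕ.+ p ^ (n / 2)) ∸ p ^ (n / 2 ∸ m)) eq))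

  off′ : ∀ β → β ≢ α → Preimage F β ↔ Fin (p ^ (n ∸ m) ∸ p ^ (n / 2 ∸ m))
  off′ β β≢α = ↔-trans (off β β≢α) (fin-≡ (cong (_∸ p ^ (n / 2 ∸ m)) eq))

  bent′ : IsBent 𝔽 (_+ₚ_ 𝔽 K) (0ₚ 𝔽 K) n m F
  bent′ v v≢0 b = ↔-trans (bent v≢0 b) (fin-≡ eq)

open import Data.Nat.Base using (_+_)
open FiniteField using (Carrier; 0#)

proposition3p2 :
  (p : ℕ) → Prime p → (n : ℕ) → 2 ∣ n → (m : ℕ) →
  (𝔽 : FiniteField p) (K : FiniteField (p ^ (n / 2))) →
  (ι : Carrier 𝔽 → Carrier K) → IsFieldEmbedding 𝔽 K ι →
  ((L : Carrier K → Space 𝔽 m) → IsLinear 𝔽 K ι L → Surjective _≡_ _≡_ L →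
   (π : Carrier K → Carrier K) → Bijective _≡_ _≡_ π →
   (ρ : Carrier K → Space 𝔽 m) →
   (y* : Carrier K) → π y* ≡ 0# K →
   let F = maioranaMcFarland 𝔽 K L π ρ
       α = ρ y*
   in (Preimage F α ↔ Fin ((p ^ (n ∸ m) + p ^ (n / 2)) ∸ p ^ (n / 2 ∸ m)))
    × (∀ β → β ≢ α → Preimage F β ↔ Fin (p ^ (n ∸ m) ∸ p ^ (n / 2 ∸ m)))
    × IsAlmostBalanced⁺ 𝔽 (_+ₚ_ 𝔽 K) (0ₚ 𝔽 K) n m F)
  ×
  ((Ψ : Carrier K → Space 𝔽 m) → IsBalanced 𝔽 n m Ψ →
   let F = partialSpread 𝔽 K Ψ
       α = Ψ (0# K)
   in (Preimage F α ↔ Fin ((p ^ (n ∸ m) + p ^ (n / 2)) ∸ p ^ (n / 2 ∸ m)))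
    × (∀ β → β ≢ α → Preimage F β ↔ Fin (p ^ (n ∸ m) ∸ p ^ (n / 2 ∸ m)))
    × IsAlmostBalanced⁺ 𝔽 (_+ₚ_ 𝔽 K) (0ₚ 𝔽 K) n m F)
proposition3p2 p p-prime n 2∣n m 𝔽 K ι _ = part₁ , part₂
  where
  open SpaceProperties 𝔽 using (space-size)
  finite = FiniteField.finite K

  1<p : 1 ℕ.< p
  1<p = ℕ.nonTrivial⇒n>1 p {{prime⇒nonTrivial p-prime}}

  -- Counting the domain gives `p ^ m * r ≡ p ^ (n / 2)`, which fixes `r` and bounds `m`.
  balanced-parameters : ∀ {r} {Ψ : Carrier K → Space 𝔽 m} → Balanced r Ψ →
                        m ≤ n / 2 × r ≡ p ^ (n / 2 ∸ m)
  balanced-parameters bal = power-divisor 1<p (balanced-size finite (space-size m) bal)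

  part₁ : _
  part₁ L linear surj π π-bij ρ y* πy*≡0
    with linear-surjective⇒balanced 𝔽 K linear surj
  ... | r , bal with balanced-parameters bal
  -- Matching on `refl` replaces the unknown kernel order by `p ^ (n / 2 ∸ m)`.
  ... | m≤k , refl = almostBalanced⁺ {n = n} 𝔽 K (q*r≡p^[n∸m] p 2∣n m≤k) _ _
    (maioranaMcFarland-derivative-balanced 𝔽 K linear bal π-bij ρ)
    (size-at-constant finite finite
      (maioranaMcFarland-constant 𝔽 K linear bal π-bij ρ πy*≡0)
      (maioranaMcFarland-balanced 𝔽 K linear bal π-bij ρ πy*≡0))
    (size-off-constant finite finite
      (maioranaMcFarland-constant 𝔽 K linear bal π-bij ρ πy*≡0)
      (maioranaMcFarland-balanced 𝔽 K linear bal π-bij ρ πy*≡0))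

  part₂ : _
  -- The fibre size of `Ψ` is prescribed, so counting only has to supply `m ≤ n / 2`.
  part₂ Ψ bal = almostBalanced⁺ {n = n} 𝔽 K (q*r≡p^[n∸m] p 2∣n (proj₁ (balanced-parameters bal))) _ _
    (partialSpread-derivative-balanced 𝔽 K bal)
    (size-at-constant finite finite (partialSpread-constant 𝔽 K bal) (partialSpread-balanced 𝔽 K bal))
    (size-off-constant finite finite (partialSpread-constant 𝔽 K bal) (partialSpread-balanced 𝔽 K bal))
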